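{- Let $\mathfrak{B}$ be the natural deduction system of bilateral classical logic described in the context (with non-contradiction applicable to arbitrary, not only atomic, signed formulas). For every deduction $\Pi$ in $\mathfrak{B}$ of a conclusion $\alpha$ from a set $\Gamma$ of undischarged assumptions, there exists a deduction in $\mathfrak{B}$ of $\alpha$ that is in normal form and whose undischarged assumptions are among $\Gamma$.
   Context: Formulas $A,B,\dots$ of propositional logic are built from atoms with $\land,\lor,\supset,\neg$. A signed formula is $+\,A$ (assertion) or $-\,A$ (denial); $\bot$ is a separate symbol that is not a signed formula. Letters $\alpha,\beta$ range over signed formulas, $\phi$ over signed formulas or $\bot$; $\alpha^\ast$ is $\alpha$ with its sign reversed. Deductions are trees with assumptions at the leaves, each assumption belonging to an assumption class (occurrences of different signed formulas in different classes; a whole class is discharged at once; vacuous discharge allowed); a deduction never starts with $\bot$. A single signed formula is a deduction of itself from itself. The rules of $\mathfrak{B}$ are: $+\land I$: from $+A$ and $+B$ infer $+A\land B$. $+\land E$: from $+A\land B$ infer $+A$; also infer $+B$. $-\land I$: from $-A$ infer $-A\land B$; from $-B$ infer $-A\land B$. $-\land E$: from $-A\land B$, a deduction of $\phi$ from $-A$, and a deduction of $\phi$ from $-B$, infer $\phi$, discharging $-A$ and $-B$. $+\lor I$: from $+A$ infer $+A\lor B$; from $+B$ infer $+A\lor B$. $+\lor E$: from $+A\lor B$, a deduction of $\phi$ from $+A$, and one of $\phi$ from $+B$, infer $\phi$, discharging $+A$, $+B$. $-\lor I$: from $-A$ and $-B$ infer $-A\lor B$. $-\lor E$: from $-A\lor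 B$ infer $-A$; also infer $-B$. $+\supset I$: from a deduction of $+B$ from $+A$ infer $+A\supset B$, discharging $+A$. $+\supset E$: from $+A\supset B$ and $+A$ infer $+B$. $-\supset I$: from $+A$ and $-B$ infer $-A\supset B$. $-\supset E$: from $-A\supset B$ infer $+A$; also infer $-B$. $+\neg I$: from $-A$ infer $+\neg A$. $+\neg E$: from $+\neg A$ infer $-A$. $-\neg I$: from $+A$ infer $-\neg A$. $-\neg E$: from $-\neg A$ infer $+A$. Reductio: from a deduction of $\bot$ from $\alpha^\ast$ infer $\alpha$, discharging $\alpha^\ast$. Non-contradiction: from $\alpha$ and $\alpha^\ast$ infer $\bot$ (for arbitrary signed $\alpha$). In $\pm\land E$, $\pm\lor E$, etc., the premise containing the connective is the major premise; the premises $\phi$ of $+\lor E$ and $-\land E$ are minor premises. The rules labelled $I$ are introduction rules and those labelled $E$ elimination rules. A maximal formula is a formula occurrence that is (a) conclusion of an introduction rule and major premise of an elimination rule; or (b) conclusion of reductio and major premise of an elimination rule; or (c) conclusion of reductio and premise of non-contradiction; or (d) conclusion of an introduction rule and premise of non-contradiction whose other premise is also the conclusion of an introduction rule. A segment is a sequence $C_1,\dots,C_n$ ($n\ge 2$) of formula occurrences such that $C_1$ is not the conclusion of $+\lor E$ or $-\land E$, $C_n$ is not a minor premise of $+\lor E$ or $-\land E$, and for each $i<n$, $C_i$ is a minor premise of $+\lor E$ or $-\land E$ and $C_{i+1}$ is its conclusion. A segment is maximal iff its last formula is the major premise of an elimination rule or a premise of non-contradiction. A deduction is in normal form iff it contains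 no maximal formulas and no maximal segments. -}

module Defs where

open import Data.Nat using (ℕ)
open import Data.List using (List; _∷_)
open import Data.List.Membership.Propositional using (_∈_)
open import Data.Product using (_×_; Σ)
open import Data.Sum using (_⊎_)
open import Relation.Nullary using (¬_)
open import Data.Unit using (⊤)

infixr 6 _∧_
infixr 5 _∨_
infixr 4 _⊃_
data Form : Set where
  atom : ℕ → Form
  _∧_  : Form → Form → Form
  _∨_  : Form → Form → Form
  _⊃_  : Form → Form → Form
  ¬'_  : Form → Form

data SForm : Set where
  +_ : Form → SForm
  -_ : Form → SForm

_* : SForm → SForm
(+ A) * = - A
(- A) * = + A

data Φ : Set where
  ⟨_⟩ : SForm → Φ
  ⊥'  : Φ

-- Each position of Γ is an assumption class
-- (de Bruijn style); hypotheses are always signed formulas, so a deduction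
-- never starts with ⊥.  Discharge removes the head of the context (a whole
-- class at once; vacuous discharge = the class is not used).
infix 2 _⊢_
data _⊢_ (Γ : List SForm) : Φ → Set where
  hyp   : ∀ {α} → α ∈ Γ → Γ ⊢ ⟨ α ⟩
  +∧I   : ∀ {A B} → Γ ⊢ ⟨ + A ⟩ → Γ ⊢ ⟨ + B ⟩ → Γ ⊢ ⟨ + (A ∧ B) ⟩
  +∧E₁  : ∀ {A B} → Γ ⊢ ⟨ + (A ∧ B) ⟩ → Γ ⊢ ⟨ + A ⟩
  +∧E₂  : ∀ {A B} → Γ ⊢ ⟨ + (A ∧ B) ⟩ → Γ ⊢ ⟨ + B ⟩
  -∧I₁  : ∀ {A B} → Γ ⊢ ⟨ - A ⟩ → Γ ⊢ ⟨ - (A ∧ B) ⟩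
  -∧I₂  : ∀ {A B} → Γ ⊢ ⟨ - B ⟩ → Γ ⊢ ⟨ - (A ∧ B) ⟩
  -∧E   : ∀ {A B φ} → Γ ⊢ ⟨ - (A ∧ B) ⟩ → (- A ∷ Γ) ⊢ φ → (- B ∷ Γ) ⊢ φ → Γ ⊢ φ
  +∨I₁  : ∀ {A B} → Γ ⊢ ⟨ + A ⟩ → Γ ⊢ ⟨ + (A ∨ B) ⟩
  +∨I₂  : ∀ {A B} → Γ ⊢ ⟨ + B ⟩ → Γ ⊢ ⟨ + (A ∨ B) ⟩
  +∨E   : ∀ {A B φ} → Γ ⊢ ⟨ + (A ∨ B) ⟩ → (+ A ∷ Γ) ⊢ φ → (+ B ∷ Γ) ⊢ φ → Γ ⊢ φ
  -∨I   : ∀ {A B} → Γ ⊢ ⟨ - A ⟩ → Γ ⊢ ⟨ - B ⟩ → Γ ⊢ ⟨ - (A ∨ B) ⟩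
  -∨E₁  : ∀ {A B} → Γ ⊢ ⟨ - (A ∨ B) ⟩ → Γ ⊢ ⟨ - A ⟩
  -∨E₂  : ∀ {A B} → Γ ⊢ ⟨ - (A ∨ B) ⟩ → Γ ⊢ ⟨ - B ⟩
  +⊃I   : ∀ {A B} → (+ A ∷ Γ) ⊢ ⟨ + B ⟩ → Γ ⊢ ⟨ + (A ⊃ B) ⟩
  +⊃E   : ∀ {A B} → Γ ⊢ ⟨ + (A ⊃ B) ⟩ → Γ ⊢ ⟨ + A ⟩ → Γ ⊢ ⟨ + B ⟩
  -⊃I   : ∀ {A B} → Γ ⊢ ⟨ + A ⟩ → Γ ⊢ ⟨ - B ⟩ → Γ ⊢ ⟨ - (A ⊃ B) ⟩
  -⊃E₁  : ∀ {A B} → Γ ⊢ ⟨ - (A ⊃ B) ⟩ → Γ ⊢ ⟨ + A ⟩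
  -⊃E₂  : ∀ {A B} → Γ ⊢ ⟨ - (A ⊃ B) ⟩ → Γ ⊢ ⟨ - B ⟩
  +¬I   : ∀ {A} → Γ ⊢ ⟨ - A ⟩ → Γ ⊢ ⟨ + (¬' A) ⟩
  +¬E   : ∀ {A} → Γ ⊢ ⟨ + (¬' A) ⟩ → Γ ⊢ ⟨ - A ⟩
  -¬I   : ∀ {A} → Γ ⊢ ⟨ + A ⟩ → Γ ⊢ ⟨ - (¬' A) ⟩
  -¬E   : ∀ {A} → Γ ⊢ ⟨ - (¬' A) ⟩ → Γ ⊢ ⟨ + A ⟩
  red   : ∀ {α} → (α * ∷ Γ) ⊢ ⊥' → Γ ⊢ ⟨ α ⟩
  nc    : ∀ {α} → Γ ⊢ ⟨ α ⟩ → Γ ⊢ ⟨ α * ⟩ → Γ ⊢ ⊥'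

data IsIntro {Γ} : ∀ {φ} → Γ ⊢ φ → Set where
  i+∧I  : ∀ {A B} {d : Γ ⊢ ⟨ + A ⟩} {e : Γ ⊢ ⟨ + B ⟩} → IsIntro (+∧I d e)
  i-∧I₁ : ∀ {A B} {d : Γ ⊢ ⟨ - A ⟩} → IsIntro (-∧I₁ {B = B} d)
  i-∧I₂ : ∀ {A B} {d : Γ ⊢ ⟨ - B ⟩} → IsIntro (-∧I₂ {A = A} d)
  i+∨I₁ : ∀ {A B} {d : Γ ⊢ ⟨ + A ⟩} → IsIntro (+∨I₁ {B = B} d)
  i+∨I₂ : ∀ {A B} {d : Γ ⊢ ⟨ + B ⟩} → IsIntro (+∨I₂ {A = A} d)
  i-∨I  : ∀ {A B} {d : Γ ⊢ ⟨ - A ⟩} {e : Γ ⊢ ⟨ - B ⟩} → IsIntro (-∨I d e)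
  i+⊃I  : ∀ {A B} {d : (+ A ∷ Γ) ⊢ ⟨ + B ⟩} → IsIntro (+⊃I d)
  i-⊃I  : ∀ {A B} {d : Γ ⊢ ⟨ + A ⟩} {e : Γ ⊢ ⟨ - B ⟩} → IsIntro (-⊃I d e)
  i+¬I  : ∀ {A} {d : Γ ⊢ ⟨ - A ⟩} → IsIntro (+¬I d)
  i-¬I  : ∀ {A} {d : Γ ⊢ ⟨ + A ⟩} → IsIntro (-¬I d)

data IsRed {Γ} : ∀ {φ} → Γ ⊢ φ → Set where
  isRed : ∀ {α} {d : (α * ∷ Γ) ⊢ ⊥'} → IsRed (red d)

data IsVE {Γ} : ∀ {φ} → Γ ⊢ φ → Set where
  ve+∨E : ∀ {A B φ} {m : Γ ⊢ ⟨ + (A ∨ B) ⟩} {d : (+ A ∷ Γ) ⊢ φ} {e : (+ B ∷ Γ) ⊢ φ}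
          → IsVE (+∨E m d e)
  ve-∧E : ∀ {A B φ} {m : Γ ⊢ ⟨ - (A ∧ B) ⟩} {d : (- A ∷ Γ) ⊢ φ} {e : (- B ∷ Γ) ⊢ φ}
          → IsVE (-∧E m d e)

-- Chain d : a sequence C₁, …, Cₙ (n ≥ 1) of formula occurrences ending with the
-- conclusion of d, where C₁ is not the conclusion of +∨E or -∧E and each Cᵢ
-- (i < n) is a minor premise of +∨E or -∧E whose conclusion is Cᵢ₊₁.
data Chain : ∀ {Γ φ} → Γ ⊢ φ → Set where
  start : ∀ {Γ φ} {d : Γ ⊢ φ} → ¬ IsVE d → Chain d
  +∨E₁↓ : ∀ {Γ A B φ} {m : Γ ⊢ ⟨ + (A ∨ B) ⟩} {d : (+ A ∷ Γ) ⊢ φ} {e : (+ B ∷ Γ) ⊢ φ}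
          → Chain d → Chain (+∨E m d e)
  +∨E₂↓ : ∀ {Γ A B φ} {m : Γ ⊢ ⟨ + (A ∨ B) ⟩} {d : (+ A ∷ Γ) ⊢ φ} {e : (+ B ∷ Γ) ⊢ φ}
          → Chain e → Chain (+∨E m d e)
  -∧E₁↓ : ∀ {Γ A B φ} {m : Γ ⊢ ⟨ - (A ∧ B) ⟩} {d : (- A ∷ Γ) ⊢ φ} {e : (- B ∷ Γ) ⊢ φ}
          → Chain d → Chain (-∧E m d e)
  -∧E₂↓ : ∀ {Γ A B φ} {m : Γ ⊢ ⟨ - (A ∧ B) ⟩} {d : (- A ∷ Γ) ⊢ φ} {e : (- B ∷ Γ) ⊢ φ}
          → Chain e → Chain (-∧E m d e)

-- Segment d : a segment (length n ≥ 2) whose last formula occurrence is the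
-- conclusion of d.
data Segment : ∀ {Γ φ} → Γ ⊢ φ → Set where
  seg+∨E₁ : ∀ {Γ A B φ} {m : Γ ⊢ ⟨ + (A ∨ B) ⟩} {d : (+ A ∷ Γ) ⊢ φ} {e : (+ B ∷ Γ) ⊢ φ}
            → Chain d → Segment (+∨E m d e)
  seg+∨E₂ : ∀ {Γ A B φ} {m : Γ ⊢ ⟨ + (A ∨ B) ⟩} {d : (+ A ∷ Γ) ⊢ φ} {e : (+ B ∷ Γ) ⊢ φ}
            → Chain e → Segment (+∨E m d e)
  seg-∧E₁ : ∀ {Γ A B φ} {m : Γ ⊢ ⟨ - (A ∧ B) ⟩} {d : (- A ∷ Γ) ⊢ φ} {e : (- B ∷ Γ) ⊢ φ}
            → Chain d → Segment (-∧E m d e)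
  seg-∧E₂ : ∀ {Γ A B φ} {m : Γ ⊢ ⟨ - (A ∧ B) ⟩} {d : (- A ∷ Γ) ⊢ φ} {e : (- B ∷ Γ) ⊢ φ}
            → Chain e → Segment (-∧E m d e)

-- The conclusion of m, used as MAJOR premise of an elimination rule, is a
-- maximal formula (cases (a), (b)) or the last formula of a maximal segment.
BadMajor : ∀ {Γ φ} → Γ ⊢ φ → Set
BadMajor m = IsIntro m ⊎ IsRed m ⊎ Segment m

-- The conclusions of d and e, used as the two premises of non-contradiction,
-- contain a maximal formula (cases (c), (d)) or end a maximal segment.
BadNC : ∀ {Γ φ ψ} → Γ ⊢ φ → Γ ⊢ ψ → Set
BadNC d e = IsRed d ⊎ IsRed e ⊎ (IsIntro d × IsIntro e) ⊎ Segment d ⊎ Segment e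

Normal : ∀ {Γ φ} → Γ ⊢ φ → Set
Normal (hyp x)     = ⊤
Normal (+∧I d e)   = Normal d × Normal e
Normal (+∧E₁ m)    = ¬ BadMajor m × Normal m
Normal (+∧E₂ m)    = ¬ BadMajor m × Normal m
Normal (-∧I₁ d)    = Normal d
Normal (-∧I₂ d)    = Normal d
Normal (-∧E m d e) = ¬ BadMajor m × Normal m × Normal d × Normal e
Normal (+∨I₁ d)    = Normal d
Normal (+∨I₂ d)    = Normal d
Normal (+∨E m d e) = ¬ BadMajor m × Normal m × Normal d × Normal e
Normal (-∨I d e)   = Normal d × Normal e
Normal (-∨E₁ m)    = ¬ BadMajor m × Normal m
Normal (-∨E₂ m)    = ¬ BadMajor m × Normal m
Normal (+⊃I d)     = Normal d
Normal (+⊃E m d)   = ¬ BadMajor m × Normal m × Normal d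
Normal (-⊃I d e)   = Normal d × Normal e
Normal (-⊃E₁ m)    = ¬ BadMajor m × Normal m
Normal (-⊃E₂ m)    = ¬ BadMajor m × Normal m
Normal (+¬I d)     = Normal d
Normal (+¬E m)     = ¬ BadMajor m × Normal m
Normal (-¬I d)     = Normal d
Normal (-¬E m)     = ¬ BadMajor m × Normal m
Normal (red d)     = Normal d
Normal (nc d e)    = ¬ BadNC d e × Normal d × Normal e

{-# OPTIONS --safe #-}
module Submission where

-- Soundness for two-valued valuations shows that a derivable α holds in every
-- model of Γ. Conversely, a tableau search on α* ∷ Γ either finds a model of
-- α* ∷ Γ, which is then impossible, or a normal refutation of it, which reductio
-- turns into a normal deduction of α. The search only eliminates from
-- assumptions, so its deductions can serve as major premises: a branching on
-- +A ∨ B or -A ∧ B assumes the two cases and recombines the closed branches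
-- with +∨E or -∧E, a branch for +A ⊃ B whose case -A closes continues with +B
-- by +⊃E with a reductio minor premise, and a branch closes when it records
-- both +p and -p, by non-contradiction between two such atomic deductions.

open import Defs
open import Data.Bool using (Bool; true; false)
open import Data.Nat using (ℕ; _≟_)
open import Data.Empty using (⊥; ⊥-elim)
open import Data.List using (List; []; _∷_)
open import Data.List.Membership.Propositional using (_∈_)
open import Data.List.Membership.DecPropositional _≟_ using (_∈?_)
open import Data.List.Relation.Binary.Subset.Propositional using (_⊆_)
open import Data.List.Relation.Binary.Subset.Propositional.Properties using (⊆-refl; ⊆-trans; ∷⁺ʳ; xs⊆x∷xs)
open import Data.List.Relation.Unary.All as All using (All; []; _∷_)
open import Data.List.Relation.Unary.All.Properties using (¬Any⇒All¬)
open import Data.List.Relation.Unary.Any using (here; any?)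
open import Data.Product using (Σ; _×_; _,_; proj₁; proj₂; map; map₁; map₂; uncurry)
open import Data.Sum using (_⊎_; inj₁; inj₂; swap)
open import Data.Unit using (⊤; tt)
open import Relation.Binary.PropositionalEquality using (_≡_; refl; sym; trans)
open import Relation.Nullary using (¬_; yes; no; does)
open import Relation.Nullary.Decidable using (dec-true; dec-false)

Valuation : Set
Valuation = ℕ → Bool

infix 3 _⊨⁺_ _⊨⁻_ _⊨_ _⊨Φ_

_⊨⁺_ _⊨⁻_ : Valuation → Form → Set
v ⊨⁺ atom p = v p ≡ true
v ⊨⁺ A ∧ B  = v ⊨⁺ A × v ⊨⁺ B
v ⊨⁺ A ∨ B  = v ⊨⁺ A ⊎ v ⊨⁺ B
v ⊨⁺ A ⊃ B  = v ⊨⁻ A ⊎ v ⊨⁺ B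
v ⊨⁺ ¬' A   = v ⊨⁻ A
v ⊨⁻ atom p = v p ≡ false
v ⊨⁻ A ∧ B  = v ⊨⁻ A ⊎ v ⊨⁻ B
v ⊨⁻ A ∨ B  = v ⊨⁻ A × v ⊨⁻ B
v ⊨⁻ A ⊃ B  = v ⊨⁺ A × v ⊨⁻ B
v ⊨⁻ ¬' A   = v ⊨⁺ A

_⊨_ : Valuation → SForm → Set
v ⊨ + A = v ⊨⁺ A
v ⊨ - A = v ⊨⁻ A

_⊨Φ_ : Valuation → Φ → Set
v ⊨Φ ⟨ α ⟩ = v ⊨ α
v ⊨Φ ⊥'    = ⊥

bivalence : ∀ v A → v ⊨⁺ A ⊎ v ⊨⁻ A
bivalence v (atom p) with v p
... | true  = inj₁ refl
... | false = inj₂ refl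
bivalence v (A ∧ B) with bivalence v A | bivalence v B
... | inj₁ a | inj₁ b = inj₁ (a , b)
... | inj₂ a | _      = inj₂ (inj₁ a)
... | _      | inj₂ b = inj₂ (inj₂ b)
bivalence v (A ∨ B) with bivalence v A | bivalence v B
... | inj₂ a | inj₂ b = inj₂ (a , b)
... | inj₁ a | _      = inj₁ (inj₁ a)
... | _      | inj₁ b = inj₁ (inj₂ b)
bivalence v (A ⊃ B) with bivalence v A | bivalence v B
... | inj₁ a | inj₂ b = inj₂ (a , b)
... | inj₂ a | _      = inj₁ (inj₁ a)
... | _      | inj₁ b = inj₁ (inj₂ b)
bivalence v (¬' A) = swap (bivalence v A)

consistency : ∀ {v} A → v ⊨⁺ A → v ⊨⁻ A → ⊥
consistency (atom p) t f with () ← trans (sym t) f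
consistency (A ∧ B) (a , b) (inj₁ a⁻)  = consistency A a a⁻
consistency (A ∧ B) (a , b) (inj₂ b⁻)  = consistency B b b⁻
consistency (A ∨ B) (inj₁ a) (a⁻ , b⁻) = consistency A a a⁻
consistency (A ∨ B) (inj₂ b) (a⁻ , b⁻) = consistency B b b⁻
consistency (A ⊃ B) (inj₁ a⁻) (a , b⁻) = consistency A a a⁻
consistency (A ⊃ B) (inj₂ b) (a , b⁻)  = consistency B b b⁻
consistency (¬' A) a⁻ a                = consistency A a a⁻

bivalence* : ∀ v α → v ⊨ α ⊎ v ⊨ α *
bivalence* v (+ A) = bivalence v A
bivalence* v (- A) = swap (bivalence v A)

consistency* : ∀ {v} α → v ⊨ α → v ⊨ α * → ⊥
consistency* (+ A) a a⁻ = consistency A a a⁻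
consistency* (- A) a⁻ a = consistency A a a⁻

soundness : ∀ {v Γ φ} → All (v ⊨_) Γ → Γ ⊢ φ → v ⊨Φ φ
soundness ρ (hyp i)     = All.lookup ρ i
soundness ρ (+∧I d e)   = soundness ρ d , soundness ρ e
soundness ρ (+∧E₁ m)    = proj₁ (soundness ρ m)
soundness ρ (+∧E₂ m)    = proj₂ (soundness ρ m)
soundness ρ (-∧I₁ d)    = inj₁ (soundness ρ d)
soundness ρ (-∧I₂ d)    = inj₂ (soundness ρ d)
soundness ρ (-∧E m d e) with soundness ρ m
... | inj₁ a = soundness (a ∷ ρ) d
... | inj₂ b = soundness (b ∷ ρ) e
soundness ρ (+∨I₁ d)    = inj₁ (soundness ρ d)
soundness ρ (+∨I₂ d)    = inj₂ (soundness ρ d)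
soundness ρ (+∨E m d e) with soundness ρ m
... | inj₁ a = soundness (a ∷ ρ) d
... | inj₂ b = soundness (b ∷ ρ) e
soundness ρ (-∨I d e)   = soundness ρ d , soundness ρ e
soundness ρ (-∨E₁ m)    = proj₁ (soundness ρ m)
soundness ρ (-∨E₂ m)    = proj₂ (soundness ρ m)
soundness {v} ρ (+⊃I {A} d) with bivalence v A
... | inj₁ a  = inj₂ (soundness (a ∷ ρ) d)
... | inj₂ a⁻ = inj₁ a⁻
soundness ρ (+⊃E {A} m d) with soundness ρ m
... | inj₁ a⁻ = ⊥-elim (consistency A (soundness ρ d) a⁻)
... | inj₂ b  = b
soundness ρ (-⊃I d e)   = soundness ρ d , soundness ρ e
soundness ρ (-⊃E₁ m)    = proj₁ (soundness ρ m)
soundness ρ (-⊃E₂ m)    = proj₂ (soundness ρ m)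
soundness ρ (+¬I d)     = soundness ρ d
soundness ρ (+¬E m)     = soundness ρ m
soundness ρ (-¬I d)     = soundness ρ d
soundness ρ (-¬E m)     = soundness ρ m
soundness {v} ρ (red {α} d) with bivalence* v α
... | inj₁ a  = a
... | inj₂ a* = ⊥-elim (soundness (a* ∷ ρ) d)
soundness ρ (nc {α} d e) = consistency* α (soundness ρ d) (soundness ρ e)

Neutral : ∀ {Γ φ} → Γ ⊢ φ → Set
Neutral d = ¬ BadMajor d × Normal d

¬BadMajor⇒¬BadNC : ∀ {Γ φ ψ} {d : Γ ⊢ φ} {e : Γ ⊢ ψ} → ¬ BadMajor d → ¬ BadMajor e → ¬ BadNC d e
¬BadMajor⇒¬BadNC ¬bd ¬be (inj₁ r)                   = ¬bd (inj₂ (inj₁ r))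
¬BadMajor⇒¬BadNC ¬bd ¬be (inj₂ (inj₁ r))            = ¬be (inj₂ (inj₁ r))
¬BadMajor⇒¬BadNC ¬bd ¬be (inj₂ (inj₂ (inj₁ (i , _)))) = ¬bd (inj₁ i)
¬BadMajor⇒¬BadNC ¬bd ¬be (inj₂ (inj₂ (inj₂ (inj₁ σ)))) = ¬bd (inj₂ (inj₂ σ))
¬BadMajor⇒¬BadNC ¬bd ¬be (inj₂ (inj₂ (inj₂ (inj₂ σ)))) = ¬be (inj₂ (inj₂ σ))

infix 2 _⊩_ _⊩⊥

-- Quantified over extensions because branchings add the assumed cases.
_⊩_ : List SForm → SForm → Set
Δ ⊩ β = ∀ {Δ'} → Δ ⊆ Δ' → Σ (Δ' ⊢ ⟨ β ⟩) Neutral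

_⊩⊥ : List SForm → Set
Δ ⊩⊥ = ∀ {Δ'} → Δ ⊆ Δ' → Σ (Δ' ⊢ ⊥') Normal

⊩-mono : ∀ {Δ Δ' β} → Δ ⊆ Δ' → Δ ⊩ β → Δ' ⊩ β
⊩-mono s g s' = g (⊆-trans s s')

hyp⊩ : ∀ {Δ β} → β ∈ Δ → Δ ⊩ β
hyp⊩ i s = hyp (s i) , (λ { (inj₁ ()) ; (inj₂ (inj₁ ())) ; (inj₂ (inj₂ ())) }) , tt

+∧E₁⊩ : ∀ {Δ A B} → Δ ⊩ + (A ∧ B) → Δ ⊩ + A
+∧E₁⊩ g s = map +∧E₁ ((λ { (inj₁ ()) ; (inj₂ (inj₁ ())) ; (inj₂ (inj₂ ())) }) ,_) (g s)

+∧E₂⊩ : ∀ {Δ A B} → Δ ⊩ + (A ∧ B) → Δ ⊩ + B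
+∧E₂⊩ g s = map +∧E₂ ((λ { (inj₁ ()) ; (inj₂ (inj₁ ())) ; (inj₂ (inj₂ ())) }) ,_) (g s)

-∨E₁⊩ : ∀ {Δ A B} → Δ ⊩ - (A ∨ B) → Δ ⊩ - A
-∨E₁⊩ g s = map -∨E₁ ((λ { (inj₁ ()) ; (inj₂ (inj₁ ())) ; (inj₂ (inj₂ ())) }) ,_) (g s)

-∨E₂⊩ : ∀ {Δ A B} → Δ ⊩ - (A ∨ B) → Δ ⊩ - B
-∨E₂⊩ g s = map -∨E₂ ((λ { (inj₁ ()) ; (inj₂ (inj₁ ())) ; (inj₂ (inj₂ ())) }) ,_) (g s)

-⊃E₁⊩ : ∀ {Δ A B} → Δ ⊩ - (A ⊃ B) → Δ ⊩ + A
-⊃E₁⊩ g s = map -⊃E₁ ((λ { (inj₁ ()) ; (inj₂ (inj₁ ())) ; (inj₂ (inj₂ ())) }) ,_) (g s)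

-⊃E₂⊩ : ∀ {Δ A B} → Δ ⊩ - (A ⊃ B) → Δ ⊩ - B
-⊃E₂⊩ g s = map -⊃E₂ ((λ { (inj₁ ()) ; (inj₂ (inj₁ ())) ; (inj₂ (inj₂ ())) }) ,_) (g s)

+¬E⊩ : ∀ {Δ A} → Δ ⊩ + (¬' A) → Δ ⊩ - A
+¬E⊩ g s = map +¬E ((λ { (inj₁ ()) ; (inj₂ (inj₁ ())) ; (inj₂ (inj₂ ())) }) ,_) (g s)

-¬E⊩ : ∀ {Δ A} → Δ ⊩ - (¬' A) → Δ ⊩ + A
-¬E⊩ g s = map -¬E ((λ { (inj₁ ()) ; (inj₂ (inj₁ ())) ; (inj₂ (inj₂ ())) }) ,_) (g s)

+⊃E⊩ : ∀ {Δ A B} → Δ ⊩ + (A ⊃ B) → (- A ∷ Δ) ⊩⊥ → Δ ⊩ + B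
+⊃E⊩ g r s =
  let m , ¬bm , nm = g s
      d , nd       = r (∷⁺ʳ _ s)
  in +⊃E m (red d) , (λ { (inj₁ ()) ; (inj₂ (inj₁ ())) ; (inj₂ (inj₂ ())) }) , ¬bm , nm , nd

+∨E⊩⊥ : ∀ {Δ A B} → Δ ⊩ + (A ∨ B) → (+ A ∷ Δ) ⊩⊥ → (+ B ∷ Δ) ⊩⊥ → Δ ⊩⊥
+∨E⊩⊥ g r₁ r₂ s =
  let m , ¬bm , nm = g s
      d₁ , n₁      = r₁ (∷⁺ʳ _ s)
      d₂ , n₂      = r₂ (∷⁺ʳ _ s)
  in +∨E m d₁ d₂ , ¬bm , nm , n₁ , n₂

-∧E⊩⊥ : ∀ {Δ A B} → Δ ⊩ - (A ∧ B) → (- A ∷ Δ) ⊩⊥ → (- B ∷ Δ) ⊩⊥ → Δ ⊩⊥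
-∧E⊩⊥ g r₁ r₂ s =
  let m , ¬bm , nm = g s
      d₁ , n₁      = r₁ (∷⁺ʳ _ s)
      d₂ , n₂      = r₂ (∷⁺ʳ _ s)
  in -∧E m d₁ d₂ , ¬bm , nm , n₁ , n₂

nc⊩⊥ : ∀ {Δ α} → Δ ⊩ α → Δ ⊩ α * → Δ ⊩⊥
nc⊩⊥ g h s =
  let d , ¬bd , nd = g s
      e , ¬be , ne = h s
  in nc d e , ¬BadMajor⇒¬BadNC ¬bd ¬be , nd , ne

Literals : List SForm → List ℕ → List ℕ → Set
Literals Δ P N = All (λ p → Δ ⊩ + atom p) P × All (λ p → Δ ⊩ - atom p) N

Satisfies : Valuation → List ℕ → List ℕ → Set
Satisfies v P N = All (λ p → v p ≡ true) P × All (λ p → v p ≡ false) N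

Outcome : List SForm → List ℕ → List ℕ → (Valuation → Set) → Set
Outcome Δ P N Q = Δ ⊩⊥ ⊎ Σ Valuation (λ v → Q v × Satisfies v P N)

-- The rest of a search, written in continuation-passing style: resumed in any
-- extension with the atoms recorded so far, it closes or yields a model of Q.
Tableau : List SForm → (Valuation → Set) → Set
Tableau Δ Q = ∀ {Δ'} → Δ ⊆ Δ' → ∀ P N → Literals Δ' P N → Outcome Δ' P N Q

Expands : List SForm → (Valuation → Set) → Set₁
Expands Δ R = ∀ {Q} → Tableau Δ Q → Tableau Δ (λ v → Q v × R v)

Tableau-map : ∀ {Δ} {Q Q' : Valuation → Set} → (∀ {v} → Q v → Q' v) → Tableau Δ Q → Tableau Δ Q'
Tableau-map f K s P N ls = Data.Sum.map₂ (map₂ (map₁ f)) (K s P N ls)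

Tableau-mono : ∀ {Δ Δ' Q} → Δ ⊆ Δ' → Tableau Δ Q → Tableau Δ' Q
Tableau-mono s K s' = K (⊆-trans s s')

Literals-mono : ∀ {Δ Δ' P N} → Δ ⊆ Δ' → Literals Δ P N → Literals Δ' P N
Literals-mono s = map (All.map (⊩-mono s)) (All.map (⊩-mono s))

Expands-map : ∀ {Δ} {R S : Valuation → Set} → (∀ {v} → R v → S v) → Expands Δ R → Expands Δ S
Expands-map f e K = Tableau-map (map₂ f) (e K)

_⊗_ : ∀ {Δ} {R S : Valuation → Set} → Expands Δ R → Expands Δ S → Expands Δ (λ v → R v × S v)
(e₁ ⊗ e₂) K = Tableau-map (λ ((q , s) , r) → q , r , s) (e₁ (e₂ K))

literal⁺ : ∀ {Δ p} → Δ ⊩ + atom p → Expands Δ (λ v → v p ≡ true)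
literal⁺ {p = p} g K s P N (gp , gn) =
  Data.Sum.map₂ (map₂ λ { (q , (t ∷ sp , sn)) → (q , t) , sp , sn }) (K s (p ∷ P) N (⊩-mono s g ∷ gp , gn))

literal⁻ : ∀ {Δ p} → Δ ⊩ - atom p → Expands Δ (λ v → v p ≡ false)
literal⁻ {p = p} g K s P N (gp , gn) =
  Data.Sum.map₂ (map₂ λ { (q , (sp , f ∷ sn)) → (q , f) , sp , sn }) (K s P (p ∷ N) (gp , ⊩-mono s g ∷ gn))

assume : ∀ {Δ Δ' γ Q} {R : Valuation → Set} → (∀ {Γ} → Γ ⊩ γ → Expands Γ R)
       → Tableau Δ Q → Δ ⊆ Δ' → ∀ P N → Literals Δ' P N → Outcome (γ ∷ Δ') P N (λ v → Q v × R v)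
assume {Δ' = Δ'} e K s P N ls =
  e (hyp⊩ (here refl)) (Tableau-mono (⊆-trans s (xs⊆x∷xs Δ' _)) K) ⊆-refl P N (Literals-mono (xs⊆x∷xs Δ' _) ls)

branch : ∀ {Δ β γ₁ γ₂} {R₁ R₂ : Valuation → Set}
       → (∀ {Γ} → Γ ⊩ β → (γ₁ ∷ Γ) ⊩⊥ → (γ₂ ∷ Γ) ⊩⊥ → Γ ⊩⊥)
       → (∀ {Γ} → Γ ⊩ γ₁ → Expands Γ R₁) → (∀ {Γ} → Γ ⊩ γ₂ → Expands Γ R₂)
       → Δ ⊩ β → Expands Δ (λ v → R₁ v ⊎ R₂ v)
branch cases e₁ e₂ g K s P N ls with assume e₁ K s P N ls
... | inj₂ (v , (q , r₁) , sat) = inj₂ (v , (q , inj₁ r₁) , sat)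
... | inj₁ ref₁ with assume e₂ K s P N ls
...   | inj₂ (v , (q , r₂) , sat) = inj₂ (v , (q , inj₂ r₂) , sat)
...   | inj₁ ref₂ = inj₁ (cases (⊩-mono s g) ref₁ ref₂)

refute-or : ∀ {Δ β γ δ} {R S : Valuation → Set}
         → (∀ {Γ} → Γ ⊩ β → (γ ∷ Γ) ⊩⊥ → Γ ⊩ δ)
         → (∀ {Γ} → Γ ⊩ γ → Expands Γ R) → (∀ {Γ} → Γ ⊩ δ → Expands Γ S)
         → Δ ⊩ β → Expands Δ (λ v → R v ⊎ S v)
refute-or rule e₁ e₂ g K s P N ls with assume e₁ K s P N ls
... | inj₂ (v , (q , r) , sat) = inj₂ (v , (q , inj₁ r) , sat)
... | inj₁ ref = Expands-map inj₂ (e₂ (rule (⊩-mono s g) ref)) (Tableau-mono s K) ⊆-refl P N ls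

expand⁺ : ∀ A {Δ} → Δ ⊩ + A → Expands Δ (λ v → v ⊨⁺ A)
expand⁻ : ∀ A {Δ} → Δ ⊩ - A → Expands Δ (λ v → v ⊨⁻ A)
expand⁺ (atom p)  = literal⁺
expand⁺ (A ∧ B) g = expand⁺ A (+∧E₁⊩ g) ⊗ expand⁺ B (+∧E₂⊩ g)
expand⁺ (A ∨ B)   = branch +∨E⊩⊥ (expand⁺ A) (expand⁺ B)
expand⁺ (A ⊃ B)   = refute-or +⊃E⊩ (expand⁻ A) (expand⁺ B)
expand⁺ (¬' A) g  = expand⁻ A (+¬E⊩ g)
expand⁻ (atom p)  = literal⁻
expand⁻ (A ∧ B)   = branch -∧E⊩⊥ (expand⁻ A) (expand⁻ B)
expand⁻ (A ∨ B) g = expand⁻ A (-∨E₁⊩ g) ⊗ expand⁻ B (-∨E₂⊩ g)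
expand⁻ (A ⊃ B) g = expand⁺ A (-⊃E₁⊩ g) ⊗ expand⁻ B (-⊃E₂⊩ g)
expand⁻ (¬' A) g  = expand⁺ A (-¬E⊩ g)

expand : ∀ β {Δ} → Δ ⊩ β → Expands Δ (_⊨ β)
expand (+ A) = expand⁺ A
expand (- A) = expand⁻ A

expandAll : ∀ {Δ βs} → All (Δ ⊩_) βs → Expands Δ (λ v → All (v ⊨_) βs)
expandAll []       = Tableau-map (_, [])
expandAll (g ∷ gs) = Expands-map (uncurry _∷_) (expand _ g ⊗ expandAll gs)

close : ∀ {Δ} → Tableau Δ (λ _ → ⊤)
close _ P N (gp , gn) with any? (_∈? P) N
... | yes clash = inj₁ (let g⁻ , q∈P = All.lookupAny gn clash in nc⊩⊥ (All.lookup gp q∈P) g⁻)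
... | no ¬clash = inj₂ ((λ p → does (p ∈? P)) , tt ,
                        All.tabulate (dec-true (_ ∈? P)) , All.map (dec-false (_ ∈? P)) (¬Any⇒All¬ N ¬clash))

normal-refutation-or-model : ∀ Γ → Σ (Γ ⊢ ⊥') Normal ⊎ Σ Valuation (λ v → All (v ⊨_) Γ)
normal-refutation-or-model Γ with expandAll (All.tabulate hyp⊩) close ⊆-refl [] [] ([] , [])
... | inj₁ ref                   = inj₁ (ref ⊆-refl)
... | inj₂ (v , (_ , v⊨Γ) , _) = inj₂ (v , v⊨Γ)

mainTheorem1 : (Γ : List SForm) (α : SForm) → Γ ⊢ ⟨ α ⟩ → Σ (Γ ⊢ ⟨ α ⟩) Normal
mainTheorem1 Γ α D with normal-refutation-or-model (α * ∷ Γ)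
... | inj₁ (d , nd)          = red d , nd
... | inj₂ (v , v⊨α* ∷ v⊨Γ) = ⊥-elim (consistency* α (soundness v⊨Γ D) v⊨α*)
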